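{- Fix an integer $\omega\ge 5$. Then every (finite, simple) claw-free graph $G$ with clique number $\omega(G)=\omega$ satisfies $\chi(G^2)\le \max\{\chi'_s(\omega),\,2\omega(\omega-1)-3\}$.
   Context: A graph is claw-free if it contains no induced subgraph isomorphic to $K_{1,3}$. The square $G^2$ of a graph $G$ is the graph on $V(G)$ in which two distinct vertices are adjacent iff they are at distance at most $2$ in $G$. $\chi$ denotes the chromatic number. For a positive integer $d$, $\chi'_s(d)$ denotes the supremum of $\chi(L^2)$ over all line graphs $L$ of simple graphs of maximum degree $d$. -}

module Defs where

open import Data.Nat using (ℕ; suc; _≤_)
open import Data.Fin using (Fin)
import Data.Fin as F
open import Data.Bool using (Bool; true; false; T)
open import Data.Product using (Σ; ∃; ∃-syntax; _×_; _,_; proj₁; proj₂)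
open import Data.Sum using (_⊎_)
open import Relation.Nullary using (¬_)
open import Relation.Binary.PropositionalEquality using (_≡_; _≢_)

record Graph : Set₁ where
  field
    V      : Set
    Adj    : V → V → Set
    sym    : ∀ {x y} → Adj x y → Adj y x
    irrefl : ∀ {x} → ¬ Adj x x
open Graph public

record SimpleGraph (n : ℕ) : Set where
  field
    adj    : Fin n → Fin n → Bool
    adj-sym    : ∀ u v → adj u v ≡ adj v u
    adj-irrefl : ∀ v → adj v v ≡ false
open SimpleGraph public

toGraph : ∀ {n} → SimpleGraph n → Graph
toGraph {n} G = record
  { V = Fin n
  ; Adj = λ u v → T (adj G u v)
  ; sym = λ {x} {y} p → subst' (adj-sym G x y) p
  ; irrefl = λ {x} p → irr (adj-irrefl G x) p
  }
  where
  subst' : ∀ {a b : Bool} → a ≡ b → T a → T b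
  subst' _≡_.refl t = t
  irr : ∀ {a : Bool} → a ≡ false → ¬ T a
  irr _≡_.refl ()

Square : Graph → Graph
Square G = record
  { V = V G
  ; Adj = λ x y → x ≢ y × (Adj G x y ⊎ ∃[ z ] (Adj G x z × Adj G z y))
  ; sym = λ { (x≢y , Data.Sum.inj₁ a) → (λ e → x≢y (symm e)) , Data.Sum.inj₁ (Graph.sym G a)
            ; (x≢y , Data.Sum.inj₂ (z , a , b)) →
                (λ e → x≢y (symm e)) , Data.Sum.inj₂ (z , Graph.sym G b , Graph.sym G a) }
  ; irrefl = λ p → proj₁ p _≡_.refl
  }
  where
  symm : ∀ {A : Set} {a b : A} → a ≡ b → b ≡ a
  symm _≡_.refl = _≡_.refl

Edge : ∀ {n} → SimpleGraph n → Set
Edge {n} H = Σ (Fin n × Fin n) λ p → (F._<_ {n} (proj₁ p) (proj₂ p)) × T (adj H (proj₁ p) (proj₂ p))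

endpoints : ∀ {n} {H : SimpleGraph n} → Edge H → Fin n × Fin n
endpoints e = proj₁ e

_∈ₑ_ : ∀ {n} {H : SimpleGraph n} → Fin n → Edge H → Set
_∈ₑ_ {H = H} x e = x ≡ proj₁ (endpoints {H = H} e) ⊎ x ≡ proj₂ (endpoints {H = H} e)

LineGraph : ∀ {n} → SimpleGraph n → Graph
LineGraph {n} H = record
  { V = Edge H
  ; Adj = λ e f → endpoints {H = H} e ≢ endpoints {H = H} f
                  × ∃[ x ] (_∈ₑ_ {H = H} x e × _∈ₑ_ {H = H} x f)
  ; sym = λ { (ne , x , a , b) → (λ q → ne (symm q)) , x , b , a }
  ; irrefl = λ p → proj₁ p _≡_.refl
  }
  where
  symm : ∀ {A : Set} {a b : A} → a ≡ b → b ≡ a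
  symm _≡_.refl = _≡_.refl

Colourable : Graph → ℕ → Set
Colourable G k = Σ (V G → Fin k) λ c → ∀ x y → Adj G x y → c x ≢ c y

IsChromaticNumber : Graph → ℕ → Set
IsChromaticNumber G k = Colourable G k × (∀ j → Colourable G j → k ≤ j)

Clique : Graph → ℕ → Set
Clique G k = Σ (Fin k → V G) λ f → ∀ i j → i ≢ j → Adj G (f i) (f j)

IsCliqueNumber : Graph → ℕ → Set
IsCliqueNumber G w = Clique G w × (∀ k → Clique G k → k ≤ w)

ClawFree : Graph → Set
ClawFree G = ¬ (Σ (V G) λ c → Σ (V G) λ a → Σ (V G) λ b → Σ (V G) λ d →
  Adj G c a × Adj G c b × Adj G c d ×
  a ≢ b × a ≢ d × b ≢ d ×
  ¬ Adj G a b × ¬ Adj G a d × ¬ Adj G b d)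

HasNeighbours : (G : Graph) → V G → ℕ → Set
HasNeighbours G v k = Σ (Fin k → V G) λ f →
  (∀ i j → f i ≡ f j → i ≡ j) × (∀ i → Adj G v (f i))

IsMaxDegree : Graph → ℕ → Set
IsMaxDegree G d = (∃[ v ] HasNeighbours G v d) × (∀ v → ¬ HasNeighbours G v (suc d))

-- c ≤ χ'_s(d) = sup { χ(L(H)²) : H finite simple graph with Δ(H) = d }.
-- For a (nonempty) set of naturals, c ≤ sup A iff some member of A is ≥ c.
_≤χ'ₛ_ : ℕ → ℕ → Set
c ≤χ'ₛ d = Σ ℕ λ m → Σ (SimpleGraph m) λ H →
  IsMaxDegree (toGraph H) d ×
  Σ ℕ λ c' → IsChromaticNumber (Square (LineGraph H)) c' × c ≤ c'

{-# OPTIONS --safe #-}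

-- Write ω = m + 1. For a vertex v and u ∈ N(v) the set N(u) ∖ N[v] is a clique, so it has at most m
-- elements, and claw-freeness forces a vertex w at distance 2 from v to have at least |N(v)| + 1 −
-- 2m neighbours in N(v). Double counting the edges between N(v) and the second neighbourhood then
-- gives deg_{G²}(v) ≤ 2ω(ω − 1) − 4, unless |N(v)| = 2m and adjacency on N(v) is transitive, so
-- that N(v) is a union of two cliques without edges between them. Call v bad if its square degree
-- exceeds this bound. The cliques N[x] ∩ N[y] with x bad and y ∈ N(x) have at most ω elements, and
-- every vertex of G lies in at most two of them, so their intersection graph H has maximum degree
-- at most ω. A bad vertex lies in exactly two of these cliques, i.e. it is an edge of H, and bad
-- vertices within distance 2 become distinct edges within distance 2 in L(H). Hence a colouring of
-- L(H)² colours the bad vertices, and the others are then coloured greedily.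

module Submission where

open import Defs
import Algebra.Properties.Semiring.Sum
open import Data.Bool using (Bool; true; false; T)
open import Data.Bool.Properties using (T?; T-irrelevant) renaming (_≟_ to _≟ᵇ_)
open import Data.Empty using (⊥; ⊥-elim)
open import Data.Fin using (Fin; zero; suc; _≟_; _↑ˡ_; _↑ʳ_; splitAt; join; inject≤; fromℕ<; funToFin; finToFun)
import Data.Fin as Fin
import Data.Fin.Properties as Finₚ
open import Data.Fin.Properties using (any?; all?; suc-injective; pigeonhole; injective⇒≤; finToFun-funToFin; splitAt-↑ˡ; splitAt-↑ʳ; join-splitAt; ↑ˡ-injective; ↑ʳ-injective; toℕ-↑ˡ; inject≤-injective)
open import Data.List using (List; []; _∷_; allFin; cartesianProduct; concatMap; deduplicate; filter; length; lookup; map)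
open import Data.List.Membership.Propositional using (_∈_; lose)
open import Data.List.Membership.Propositional.Properties using (∈-allFin; ∈-cartesianProduct⁺; ∈-concatMap⁺; ∈-deduplicate⁺; ∈-deduplicate⁻; ∈-filter⁺; ∈-filter⁻; ∈-lookup; ∈-map⁺; ∈-map⁻)
import Data.List.Relation.Unary.All as All
open import Data.List.Relation.Unary.AllPairs using (_∷_)
open import Data.List.Relation.Unary.Any as Any using (here; there)
open import Data.List.Relation.Unary.Any.Properties using (lookup-index)
open import Data.List.Relation.Unary.Unique.Propositional using (Unique)
import Data.List.Relation.Unary.Unique.DecPropositional.Properties as DecUnique
open import Data.Nat using (ℕ; zero; suc; _+_; _*_; _∸_; _^_; _⊔_; _≤_; _<_; z≤n; s≤s; s≤s⁻¹; _≤?_)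
open import Data.Nat.Properties hiding (_≟_; suc-injective)
open import Data.Nat.Solver using (module +-*-Solver)
open import Data.Product using (Σ; ∃; ∃-syntax; _×_; _,_; proj₁; proj₂)
open import Data.Product.Properties using () renaming (≡-dec to ×-≡-dec)
open import Data.Sum using (_⊎_; inj₁; inj₂; [_,_]′)
open import Data.Unit using (tt)
open import Data.Vec using (Vec; tabulate) renaming (lookup to lookupᵛ)
open import Data.Vec.Properties using (tabulate-cong; lookup∘tabulate) renaming (≡-dec to Vec-≡-dec)
open import Function using (_∘_; mk⇔)
open import Relation.Binary using (tri<; tri≈; tri>)
open import Relation.Binary.PropositionalEquality using (_≡_; _≢_; refl; cong; cong₂; subst; trans; module ≡-Reasoning) renaming (sym to ≡-sym)
open import Relation.Nullary using (¬_; Dec; yes; no; does; contradiction; ¬?; _×-dec_; _⊎-dec_; _→-dec_; decidable-stable; map′)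
open import Relation.Nullary.Decidable using (dec-true; dec-false; does-⇔)
open import Relation.Unary using (Decidable)

open Algebra.Properties.Semiring.Sum +-*-semiring using (sum; ∑-distrib-+; ∑-comm; *-distribˡ-sum; *-distribʳ-sum)

-- Counting

sum-mono-≤ : ∀ {n} {f g : Fin n → ℕ} → (∀ i → f i ≤ g i) → sum f ≤ sum g
sum-mono-≤ {zero}  f≤g = z≤n
sum-mono-≤ {suc n} f≤g = +-mono-≤ (f≤g zero) (sum-mono-≤ (f≤g ∘ suc))

term≤sum : ∀ {n} (f : Fin n → ℕ) i → f i ≤ sum f
term≤sum f zero    = m≤m+n _ _
term≤sum f (suc i) = ≤-trans (term≤sum (f ∘ suc) i) (m≤n+m _ _)

indicator : ∀ {A : Set} → Dec A → ℕ
indicator (yes _) = 1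
indicator (no _)  = 0

indicator-true : ∀ {A : Set} (A? : Dec A) → A → indicator A? ≡ 1
indicator-true (yes _) _ = refl
indicator-true (no ¬a) a = contradiction a ¬a

indicator-elim : ∀ {A : Set} (A? : Dec A) {k} → (A → 1 ≤ k) → indicator A? ≤ k
indicator-elim (yes a) h = h a
indicator-elim (no _)  _ = z≤n

indicator-cover : ∀ {A B C : Set} (A? : Dec A) (B? : Dec B) (C? : Dec C) →
  (A → B ⊎ C) → indicator A? ≤ indicator B? + indicator C?
indicator-cover A? B? C? A⊆B∪C = indicator-elim A? λ a → case (A⊆B∪C a)
  where
  case : _ ⊎ _ → 1 ≤ indicator B? + indicator C?
  case (inj₁ b) rewrite indicator-true B? b = s≤s z≤n
  case (inj₂ c) rewrite indicator-true C? c = m≤n+m 1 _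

indicator-disjoint : ∀ {A B C : Set} (A? : Dec A) (B? : Dec B) (C? : Dec C) →
  (A → C) → (B → C) → (A → ¬ B) → indicator A? + indicator B? ≤ indicator C?
indicator-disjoint (yes a) (yes b) C? A⊆C B⊆C A∩B = contradiction b (A∩B a)
indicator-disjoint (yes a) (no _)  C? A⊆C B⊆C A∩B = ≤-reflexive (≡-sym (indicator-true C? (A⊆C a)))
indicator-disjoint (no _)  B?      C? A⊆C B⊆C A∩B =
  indicator-elim B? λ b → ≤-reflexive (≡-sym (indicator-true C? (B⊆C b)))

count : ∀ {n} {P : Fin n → Set} → Decidable P → ℕ
count P? = sum (λ i → indicator (P? i))

module _ {n : ℕ} {P Q : Fin n → Set} (P? : Decidable P) (Q? : Decidable Q) where

  count-mono : (∀ {x} → P x → Q x) → count P? ≤ count Q?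
  count-mono P⊆Q = sum-mono-≤ λ x →
    indicator-elim (P? x) λ p → ≤-reflexive (≡-sym (indicator-true (Q? x) (P⊆Q p)))

  module _ {R : Fin n → Set} (R? : Decidable R) where

    count-cover : (∀ {x} → P x → Q x ⊎ R x) → count P? ≤ count Q? + count R?
    count-cover P⊆Q∪R = ≤-trans
      (sum-mono-≤ λ x → indicator-cover (P? x) (Q? x) (R? x) P⊆Q∪R)
      (≤-reflexive (∑-distrib-+ (indicator ∘ Q?) (indicator ∘ R?)))

    count-disjoint : (∀ {x} → P x → R x) → (∀ {x} → Q x → R x) → (∀ {x} → P x → ¬ Q x) →
      count P? + count Q? ≤ count R?
    count-disjoint P⊆R Q⊆R P∩Q = ≤-trans
      (≤-reflexive (≡-sym (∑-distrib-+ (indicator ∘ P?) (indicator ∘ Q?))))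
      (sum-mono-≤ λ x → indicator-disjoint (P? x) (Q? x) (R? x) P⊆R Q⊆R P∩Q)

count-inhabited : ∀ {n} {P : Fin n → Set} (P? : Decidable P) {x} → P x → 1 ≤ count P?
count-inhabited P? {x} p = ≤-trans (≤-reflexive (≡-sym (indicator-true (P? x) p))) (term≤sum (indicator ∘ P?) x)

record Enumeration {n} (P : Fin n → Set) (k : ℕ) : Set where
  field
    element   : Fin k → Fin n
    injective : ∀ {i j} → element i ≡ element j → i ≡ j
    sound     : ∀ i → P (element i)
    complete  : ∀ {x} → P x → ∃[ i ] element i ≡ x

open Enumeration

enumerate : ∀ {n} {P : Fin n → Set} (P? : Decidable P) → Enumeration P (count P?)
enumerate {zero} P? = record
  { element = λ () ; injective = λ { {()} } ; sound = λ () ; complete = λ { {()} } }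
enumerate {suc n} {P} P? = extend (P? zero) (enumerate (P? ∘ suc))
  where
  extend : ∀ {k} (P₀? : Dec (P zero)) → Enumeration (P ∘ suc) k → Enumeration P (indicator P₀? + k)
  extend {k} (yes p₀) e = record
    { element = element′ ; injective = injective′ ; sound = sound′ ; complete = complete′ }
    where
    element′ : Fin (suc k) → Fin (suc n)
    element′ zero    = zero
    element′ (suc i) = suc (element e i)
    injective′ : ∀ {i j} → element′ i ≡ element′ j → i ≡ j
    injective′ {zero}  {zero}  _  = refl
    injective′ {suc i} {suc j} eq = cong suc (injective e (suc-injective eq))
    sound′ : ∀ i → P (element′ i)
    sound′ zero    = p₀
    sound′ (suc i) = sound e i
    complete′ : ∀ {x} → P x → ∃[ i ] element′ i ≡ x
    complete′ {zero}  _ = zero , refl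
    complete′ {suc x} p with i , eq ← complete e p = suc i , cong suc eq
  extend (no ¬p₀) e = record
    { element = suc ∘ element e
    ; injective = injective e ∘ suc-injective
    ; sound = sound e
    ; complete = λ { {zero} p → contradiction p ¬p₀
                   ; {suc x} p → let i , eq = complete e p in i , cong suc eq } }

count-subsingleton : ∀ {n} {P : Fin n → Set} (P? : Decidable P) →
  (∀ {x y} → P x → P y → x ≡ y) → count P? ≤ 1
count-subsingleton {P = P} P? unique = bound (enumerate P?)
  where
  bound : ∀ {k} → Enumeration P k → k ≤ 1
  bound {zero}        e = z≤n
  bound {suc zero}    e = s≤s z≤n
  bound {suc (suc k)} e with () ← injective e {zero} {suc zero} (unique (sound e _) (sound e _))

-- Cliques in a claw-free graph

module ClawFreeGraph {n : ℕ} (G : SimpleGraph n) (claw-free : ClawFree (toGraph G))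
  (m : ℕ) (clique≤1+m : ∀ k → Clique (toGraph G) k → k ≤ suc m) where

  infix 4 _~_ _~?_ _≈_ _≈?_

  _~_ : Fin n → Fin n → Set
  x ~ y = T (adj G x y)

  _~?_ : ∀ x y → Dec (x ~ y)
  x ~? y = T? (adj G x y)

  ~-sym : ∀ {x y} → x ~ y → y ~ x
  ~-sym = Graph.sym (toGraph G)

  ~⇒≢ : ∀ {x y} → x ~ y → x ≢ y
  ~⇒≢ x~x refl = Graph.irrefl (toGraph G) x~x

  -- Closed adjacency, so that cliques need no distinctness condition.
  _≈_ : Fin n → Fin n → Set
  x ≈ y = x ≡ y ⊎ x ~ y

  _≈?_ : ∀ x y → Dec (x ≈ y)
  x ≈? y = (x ≟ y) ⊎-dec (x ~? y)

  ≈-sym : ∀ {x y} → x ≈ y → y ≈ x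
  ≈-sym (inj₁ eq)  = inj₁ (≡-sym eq)
  ≈-sym (inj₂ x~y) = inj₂ (~-sym x~y)

  -- Otherwise `v` and the three vertices would be an induced claw. All later uses of claw-freeness
  -- go through this form.
  two-of-three-close : ∀ {v x y z} → v ~ x → v ~ y → v ~ z → x ≈ y ⊎ x ≈ z ⊎ y ≈ z
  two-of-three-close {v} {x} {y} {z} v~x v~y v~z with x ≈? y | x ≈? z | y ≈? z
  ... | yes x≈y | _       | _       = inj₁ x≈y
  ... | no _    | yes x≈z | _       = inj₂ (inj₁ x≈z)
  ... | no _    | no _    | yes y≈z = inj₂ (inj₂ y≈z)
  ... | no x≉y  | no x≉z  | no y≉z  = ⊥-elim (claw-free
    (v , x , y , z , v~x , v~y , v~z , x≉y ∘ inj₁ , x≉z ∘ inj₁ , y≉z ∘ inj₁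
       , x≉y ∘ inj₂ , x≉z ∘ inj₂ , y≉z ∘ inj₂))

  IsClique : (Fin n → Set) → Set
  IsClique P = ∀ {x y} → P x → P y → x ≈ y

  clique⊎nonadjacent : ∀ {P} → Decidable P → IsClique P ⊎ ∃[ x ] ∃[ y ] (P x × P y × ¬ x ≈ y)
  clique⊎nonadjacent P? with any? (λ x → any? λ y → P? x ×-dec P? y ×-dec ¬? (x ≈? y))
  ... | yes (x , y , h) = inj₂ (x , y , h)
  ... | no none = inj₁ λ {x} {y} p q → decidable-stable (x ≈? y) λ x≉y → none (x , y , p , q , x≉y)

  clique-count : ∀ {P} (P? : Decidable P) → IsClique P → count P? ≤ suc m
  clique-count P? clique = clique≤1+m _ (element e , adjacent)
    where
    e = enumerate P?
    adjacent : ∀ i j → i ≢ j → element e i ~ element e j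
    adjacent i j i≢j with clique (sound e i) (sound e j)
    ... | inj₁ eq  = contradiction (injective e eq) i≢j
    ... | inj₂ i~j = i~j

  insert? : ∀ {P : Fin n → Set} → Decidable P → ∀ u → Decidable (λ x → x ≡ u ⊎ P x)
  insert? P? u x = (x ≟ u) ⊎-dec P? x

  insert-clique : ∀ {P u} → IsClique P → (∀ {x} → P x → u ~ x) → IsClique (λ x → x ≡ u ⊎ P x)
  insert-clique clique P⊆N (inj₁ refl) (inj₁ refl) = inj₁ refl
  insert-clique clique P⊆N (inj₁ refl) (inj₂ q)    = inj₂ (P⊆N q)
  insert-clique clique P⊆N (inj₂ p)    (inj₁ refl) = inj₂ (~-sym (P⊆N p))
  insert-clique clique P⊆N (inj₂ p)    (inj₂ q)    = clique p q

  count-insert : ∀ {P : Fin n → Set} (P? : Decidable P) {u} → ¬ P u → suc (count P?) ≤ count (insert? P? u)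
  count-insert P? {u} ¬pu = ≤-trans
    (+-monoˡ-≤ (count P?) (count-inhabited (_≟ u) refl))
    (count-disjoint (_≟ u) P? (insert? P? u) inj₁ inj₂ λ { refl p → ¬pu p })

  -- Adding `u` gives a larger clique, still of size at most m + 1.
  neighbour-clique-count : ∀ {P u} (P? : Decidable P) → IsClique P → (∀ {x} → P x → u ~ x) →
    count P? ≤ m
  neighbour-clique-count {u = u} P? clique P⊆N = s≤s⁻¹ (≤-trans
    (count-insert P? λ p → ~⇒≢ (P⊆N p) refl)
    (clique-count (insert? P? u) (insert-clique clique P⊆N)))

  -- Both `u` and `v` can be added to the clique, which saves one more.
  common-neighbour-clique-count : ∀ {P u v} (P? : Decidable P) → IsClique P → u ~ v →
    (∀ {x} → P x → u ~ x) → (∀ {x} → P x → v ~ x) → suc (count P?) ≤ m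
  common-neighbour-clique-count {u = u} P? clique u~v P⊆Nu P⊆Nv = ≤-trans
    (count-insert P? λ p → ~⇒≢ (P⊆Nu p) refl)
    (neighbour-clique-count (insert? P? u) (insert-clique clique P⊆Nu)
      λ { (inj₁ refl) → ~-sym u~v ; (inj₂ p) → P⊆Nv p })

  -- A weak form of the bound on the Ramsey number R(3, k + 1).
  count≤k*1+k : ∀ k {P : Fin n → Set} (P? : Decidable P) →
    (∀ {x y z} → P x → P y → P z → x ≈ y ⊎ x ≈ z ⊎ y ≈ z) →
    (∀ {Q} (Q? : Decidable Q) → (∀ {x} → Q x → P x) → IsClique Q → count Q? ≤ k) →
    count P? ≤ k * suc k
  count≤k*1+k zero P? _ cliques≤0 = cliques≤0 P? (λ p → p)
    λ {x} p _ → contradiction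
      (≤-trans (count-inhabited (_≟ x) refl)
        (cliques≤0 (_≟ x) (λ { refl → p }) λ { refl refl → inj₁ refl }))
      λ ()
  count≤k*1+k (suc k) {P} P? α≤2 cliques≤1+k with any? P?
  ... | no empty = cover-by-nothing
    where
    cover-by-nothing : count P? ≤ suc k * suc (suc k)
    cover-by-nothing = ≤-trans
      (cliques≤1+k P? (λ p → p) λ {x} p _ → contradiction (x , p) empty)
      (m≤m*n (suc k) (suc (suc k)))
  ... | yes (u , pu) = begin
    count P?                                      ≤⟨ count-cover P? u? rest? (λ {x} → split {x}) ⟩
    count u? + count rest?                        ≤⟨ +-mono-≤ (count-subsingleton u? λ { refl refl → refl })
                                                       (count-cover rest? near? far? (λ z → z)) ⟩
    1 + (count near? + count far?)                ≤⟨ +-monoʳ-≤ 1 (+-mono-≤ near≤ far≤) ⟩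
    1 + (k * suc k + suc k)                       ≤⟨ m≤m+n _ k ⟩
    1 + (k * suc k + suc k) + k                   ≡⟨ solve 1 (λ k → con 1 :+ (k :* (con 1 :+ k) :+ (con 1 :+ k)) :+ k
                                                       := (con 1 :+ k) :* (con 2 :+ k)) refl k ⟩
    suc k * suc (suc k)                           ∎
    where
    open ≤-Reasoning
    open +-*-Solver
    u? = _≟ u
    near? = λ x → P? x ×-dec (u ~? x)
    far? = λ x → P? x ×-dec ¬? (u ≈? x)
    rest? = λ x → near? x ⊎-dec far? x
    split : ∀ {x} → P x → x ≡ u ⊎ (P x × u ~ x) ⊎ (P x × ¬ u ≈ x)
    split {x} p with u ≈? x
    ... | yes (inj₁ eq)  = inj₁ (≡-sym eq)
    ... | yes (inj₂ u~x) = inj₂ (inj₁ (p , u~x))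
    ... | no u≉x         = inj₂ (inj₂ (p , u≉x))
    -- A clique among the neighbours of `u` extends by `u`, so the clique bound drops to k and
    -- induction applies.
    near≤ : count near? ≤ k * suc k
    near≤ = count≤k*1+k k near? (λ p q r → α≤2 (proj₁ p) (proj₁ q) (proj₁ r))
      λ Q? Q⊆near clique → s≤s⁻¹ (≤-trans
        (count-insert Q? λ q → ~⇒≢ (proj₂ (Q⊆near q)) refl)
        (cliques≤1+k (insert? Q? u) (λ { (inj₁ refl) → pu ; (inj₂ q) → proj₁ (Q⊆near q) })
          (insert-clique clique (λ q → proj₂ (Q⊆near q)))))
    -- Two nonadjacent vertices far from `u` would violate `α≤2` together with `u`.
    far≤ : count far? ≤ suc k
    far≤ = cliques≤1+k far? proj₁ far-clique
      where
      far-clique : IsClique (λ x → P x × ¬ u ≈ x)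
      far-clique (p , u≉x) (q , u≉y) with α≤2 pu p q
      ... | inj₁ u≈x        = contradiction u≈x u≉x
      ... | inj₂ (inj₁ u≈y) = contradiction u≈y u≉y
      ... | inj₂ (inj₂ x≈y) = x≈y

  -- Square degrees

  module Neighbourhood (v : Fin n) where

    d : ℕ
    d = count (v ~?_)

    Outside : Fin n → Fin n → Set
    Outside u w = v ~ u × u ~ w × ¬ v ≈ w

    outside? : ∀ u → Decidable (Outside u)
    outside? u w = (v ~? u) ×-dec (u ~? w) ×-dec ¬? (v ≈? w)

    common? : ∀ u → Decidable (λ x → v ~ x × u ~ x)
    common? u x = (v ~? x) ×-dec (u ~? x)

    Second : Fin n → Set
    Second w = ¬ v ≈ w × ∃[ u ] (v ~ u × u ~ w)

    second? : Decidable Second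
    second? w = ¬? (v ≈? w) ×-dec any? (λ u → (v ~? u) ×-dec (u ~? w))

    SquareAdj : Fin n → Set
    SquareAdj = Adj (Square (toGraph G)) v

    squareAdj? : Decidable SquareAdj
    squareAdj? w = ¬? (v ≟ w) ×-dec ((v ~? w) ⊎-dec any? (λ u → (v ~? u) ×-dec (u ~? w)))

    squareDegree≤ : count squareAdj? ≤ d + count second?
    squareDegree≤ = count-cover squareAdj? (v ~?_) second? split
      where
      split : ∀ {w} → SquareAdj w → v ~ w ⊎ Second w
      split (_ , inj₁ v~w) = inj₁ v~w
      split {w} (v≢w , inj₂ path) with v ~? w
      ... | yes v~w = inj₁ v~w
      ... | no v≁w  = inj₂ ([ v≢w , v≁w ]′ , path)

    -- Two nonadjacent vertices of this set would form a claw at `u` together with `v`.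
    count-outside : ∀ u → count (outside? u) ≤ m
    count-outside u = neighbour-clique-count (outside? u) clique λ (_ , u~w , _) → u~w
      where
      clique : IsClique (Outside u)
      clique (v~u , u~x , v≉x) (_ , u~y , v≉y) with two-of-three-close (~-sym v~u) u~x u~y
      ... | inj₁ v≈x        = contradiction v≈x v≉x
      ... | inj₂ (inj₁ v≈y) = contradiction v≈y v≉y
      ... | inj₂ (inj₂ x≈y) = x≈y

    -- Sums the weight `g u` over the edges from N(v) to the second neighbourhood in both orders:
    -- each `w` collects at least `t`, and each `u` has at most `m` such edges.
    double-count : ∀ (g : Fin n → ℕ) t →
      (∀ {w} → Second w → t ≤ sum (λ u → g u * indicator (outside? u w))) →
      t * count second? ≤ sum g * m
    double-count g t h = begin
      t * count second?                                          ≡⟨ *-distribˡ-sum t (indicator ∘ second?) ⟩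
      sum (λ w → t * indicator (second? w))                      ≤⟨ sum-mono-≤ pointwise ⟩
      sum (λ w → sum (λ u → g u * indicator (outside? u w)))     ≡⟨ ∑-comm (λ w u → g u * indicator (outside? u w)) ⟩
      sum (λ u → sum (λ w → g u * indicator (outside? u w)))     ≤⟨ sum-mono-≤ (λ u → ≤-trans
          (≤-reflexive (≡-sym (*-distribˡ-sum (g u) (indicator ∘ outside? u))))
          (*-monoʳ-≤ (g u) (count-outside u))) ⟩
      sum (λ u → g u * m)                                        ≡⟨ ≡-sym (*-distribʳ-sum m g) ⟩
      sum g * m                                                  ∎
      where
      open ≤-Reasoning
      pointwise : ∀ w → t * indicator (second? w) ≤ sum (λ u → g u * indicator (outside? u w))
      pointwise w with second? w
      ... | yes s = ≤-trans (≤-reflexive (*-identityʳ t)) (h s)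
      ... | no _  = ≤-trans (≤-reflexive (*-zeroʳ t)) z≤n

    feet? : ∀ w → Decidable (λ u → v ~ u × u ~ w)
    feet? w u = (v ~? u) ×-dec (u ~? w)

    N : Fin n → ℕ
    N u = indicator (v ~? u)

    count-feet≤ : ∀ {w} → Second w → count (feet? w) ≤ sum (λ u → N u * indicator (outside? u w))
    count-feet≤ {w} (v≉w , _) = sum-mono-≤ λ u → indicator-elim (feet? w u)
      λ (v~u , u~w) → ≤-reflexive (≡-sym (trans
        (cong (_* indicator (outside? u w)) (indicator-true (v ~? u) v~u))
        (trans (*-identityˡ _) (indicator-true (outside? u w) (v~u , u~w , v≉w)))))

    -- The vertices of N(v) that are neither `u` nor adjacent to it form a clique, by claw-freeness
    -- at `v`, so there are at most m of them.
    count-common≥ : ∀ {u} → v ~ u → d ≤ 1 + count (common? u) + m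
    count-common≥ {u} v~u = begin
      d                                          ≤⟨ count-cover (v ~?_) near? far? split ⟩
      count near? + count far?                   ≤⟨ +-mono-≤ (count-cover near? (_≟ u) (common? u) (λ z → z))
                                                      (neighbour-clique-count far? far-clique proj₁) ⟩
      count (_≟ u) + count (common? u) + m       ≤⟨ +-monoˡ-≤ m (+-monoˡ-≤ _ (count-subsingleton (_≟ u) λ { refl refl → refl })) ⟩
      1 + count (common? u) + m                  ∎
      where
      open ≤-Reasoning
      near? = insert? (common? u) u
      far? = λ x → (v ~? x) ×-dec ¬? (u ≈? x)
      split : ∀ {x} → v ~ x → (x ≡ u ⊎ v ~ x × u ~ x) ⊎ (v ~ x × ¬ u ≈ x)
      split {x} v~x with u ≈? x
      ... | yes (inj₁ eq)  = inj₁ (inj₁ (≡-sym eq))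
      ... | yes (inj₂ u~x) = inj₁ (inj₂ (v~x , u~x))
      ... | no u≉x         = inj₂ (v~x , u≉x)
      far-clique : IsClique (λ x → v ~ x × ¬ u ≈ x)
      far-clique (v~x , u≉x) (v~y , u≉y) with two-of-three-close v~u v~x v~y
      ... | inj₁ u≈x        = contradiction u≈x u≉x
      ... | inj₂ (inj₁ u≈y) = contradiction u≈y u≉y
      ... | inj₂ (inj₂ x≈y) = x≈y

    -- Among `u` and the common neighbours of `u` and `v`, those adjacent to `w` are feet of `w`.
    -- The others form a clique by claw-freeness at `u`; since `u` and `v` can both be added to it,
    -- it has at most m - 1 vertices.
    count-common≤ : ∀ {u w} → Outside u w → 2 + count (common? u) ≤ count (feet? w) + m
    count-common≤ {u} {w} (v~u , u~w , v≉w) = begin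
      2 + count (common? u)                      ≤⟨ s≤s (count-insert (common? u) λ (_ , u~u) → ~⇒≢ u~u refl) ⟩
      1 + count (insert? (common? u) u)          ≤⟨ s≤s (count-cover (insert? (common? u) u) (feet? w) miss? split) ⟩
      1 + (count (feet? w) + count miss?)        ≡⟨ ≡-sym (+-suc _ _) ⟩
      count (feet? w) + suc (count miss?)        ≤⟨ +-monoʳ-≤ _ (common-neighbour-clique-count miss? miss-clique v~u
                                                      proj₁ (proj₁ ∘ proj₂)) ⟩
      count (feet? w) + m                        ∎
      where
      open ≤-Reasoning
      Miss = λ x → v ~ x × u ~ x × ¬ w ~ x
      miss? : Decidable Miss
      miss? x = (v ~? x) ×-dec (u ~? x) ×-dec ¬? (w ~? x)
      split : ∀ {x} → x ≡ u ⊎ (v ~ x × u ~ x) → (v ~ x × x ~ w) ⊎ Miss x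
      split (inj₁ refl) = inj₁ (v~u , u~w)
      split {x} (inj₂ (v~x , u~x)) with w ~? x
      ... | yes w~x = inj₁ (v~x , ~-sym w~x)
      ... | no w≁x  = inj₂ (v~x , u~x , w≁x)
      w≉ : ∀ {x} → Miss x → ¬ w ≈ x
      w≉ (v~x , _ , w≁x) (inj₁ refl) = v≉w (inj₂ v~x)
      w≉ (v~x , _ , w≁x) (inj₂ w~x)  = w≁x w~x
      miss-clique : IsClique Miss
      miss-clique p@(_ , u~x , _) q@(_ , u~y , _) with two-of-three-close u~w u~x u~y
      ... | inj₁ w≈x        = contradiction w≈x (w≉ p)
      ... | inj₂ (inj₁ w≈y) = contradiction w≈y (w≉ q)
      ... | inj₂ (inj₂ x≈y) = x≈y

    -- Chains the two estimates for one foot `u`, which eliminates the number of common neighbours.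
    count-feet≥ : ∀ {w} → Second w → d + 1 ≤ count (feet? w) + (m + m)
    count-feet≥ {w} (v≉w , u , v~u , u~w) = begin
      d + 1                              ≤⟨ +-monoˡ-≤ 1 (count-common≥ v~u) ⟩
      1 + count (common? u) + m + 1      ≡⟨ solve 2 (λ c m → con 1 :+ c :+ m :+ con 1 := con 2 :+ c :+ m) refl (count (common? u)) m ⟩
      2 + count (common? u) + m          ≤⟨ +-monoˡ-≤ m (count-common≤ (v~u , u~w , v≉w)) ⟩
      count (feet? w) + m + m            ≡⟨ +-assoc _ m m ⟩
      count (feet? w) + (m + m)          ∎
      where
      open ≤-Reasoning
      open +-*-Solver

    -- With ω = m + 1 the square degree is at most 2ω(ω - 1) - 4, written without truncated
    -- subtraction.
    Good : Set
    Good = count squareAdj? + 4 ≤ 2 * suc m * m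

    -- N(v) is a union of cliques without edges between them, at most two by claw-freeness; with
    -- `TwoSided` there are exactly two.
    Cluster : Set
    Cluster = ∀ {x y z} → v ~ x → v ~ y → v ~ z → x ≈ y → y ≈ z → x ≈ z

    TwoSided : Set
    TwoSided = ∃[ x ] ∃[ y ] (v ~ x × v ~ y × ¬ x ≈ y)

    -- Case analysis on the degree of a vertex

    module _ (4≤m : 4 ≤ m) where

      -- Every second neighbour has a foot, so there are at most dm of them, and d + dm + 4 ≤ d + dm
      -- + m < (d + 1)(m + 1) ≤ 2m(m + 1).
      good-if-few : d < m + m → Good
      good-if-few d<2m = begin
        count squareAdj? + 4        ≤⟨ +-mono-≤ squareDegree≤ 4≤m ⟩
        d + count second? + m       ≤⟨ +-monoˡ-≤ m (+-monoʳ-≤ d second≤) ⟩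
        d + d * m + m               ≤⟨ n≤1+n _ ⟩
        1 + (d + d * m + m)         ≡⟨ solve 2 (λ d m → con 1 :+ (d :+ d :* m :+ m) := (con 1 :+ d) :* (con 1 :+ m)) refl d m ⟩
        suc d * suc m               ≤⟨ *-monoˡ-≤ (suc m) d<2m ⟩
        (m + m) * suc m             ≡⟨ solve 1 (λ m → (m :+ m) :* (con 1 :+ m) := con 2 :* (con 1 :+ m) :* m) refl m ⟩
        2 * suc m * m               ∎
        where
        open ≤-Reasoning
        open +-*-Solver
        second≤ : count second? ≤ d * m
        second≤ = subst (_≤ d * m) (*-identityˡ _) (double-count N 1
          λ {w} s@(_ , u , path) → ≤-trans (count-inhabited (feet? w) path) (count-feet≤ s))

      -- With d = 2m + 1 + s every second neighbour has at least 2 + s feet, so (2 + s)S ≤ dm. The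
      -- surplus s enters quadratically and is controlled by the Ramsey-type bound on d.
      good-if-many : m + m < d → Good
      good-if-many 2m<d with s , refl-d ← m≤n⇒∃[o]m+o≡n 2m<d = begin
        count squareAdj? + 4                 ≤⟨ +-monoˡ-≤ 4 squareDegree≤ ⟩
        d + count second? + 4                ≡⟨ cong (λ z → z + count second? + 4) (≡-sym refl-d) ⟩
        suc (m + m) + s + S + 4              ≡⟨ solve 3 (λ m s S → con 1 :+ (m :+ m) :+ s :+ S :+ con 4 := (S :+ s :+ con 5) :+ (m :+ m)) refl m s S ⟩
        (S + s + 5) + (m + m)                ≤⟨ +-monoˡ-≤ (m + m) (*-cancelˡ-≤ {S + s + 5} {2 * (m * m)} (2 + s) scaled) ⟩
        2 * (m * m) + (m + m)                ≡⟨ solve 1 (λ m → con 2 :* (m :* m) :+ (m :+ m) := con 2 :* (con 1 :+ m) :* m) refl m ⟩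
        2 * suc m * m                        ∎
        where
        open ≤-Reasoning
        open +-*-Solver
        S = count second?
        feet≥2+s : ∀ {w} → Second w → 2 + s ≤ count (feet? w)
        feet≥2+s {w} sec = +-cancelʳ-≤ (m + m) _ _ (subst (_≤ count (feet? w) + (m + m))
          (trans (cong (_+ 1) (≡-sym refl-d))
            (solve 2 (λ m s → con 1 :+ (m :+ m) :+ s :+ con 1 := con 2 :+ s :+ (m :+ m)) refl m s))
          (count-feet≥ sec))
        counted : (2 + s) * S ≤ (suc (m + m) + s) * m
        counted = subst (λ z → (2 + s) * S ≤ z * m) (≡-sym refl-d)
          (double-count N (2 + s) λ sec → ≤-trans (feet≥2+s sec) (count-feet≤ sec))
        s+m+1≤m² : s + m + 1 ≤ m * m
        s+m+1≤m² = +-cancelʳ-≤ m _ _ (begin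
          s + m + 1 + m     ≡⟨ solve 2 (λ m s → s :+ m :+ con 1 :+ m := con 1 :+ (m :+ m) :+ s) refl m s ⟩
          suc (m + m) + s   ≡⟨ refl-d ⟩
          d                 ≤⟨ count≤k*1+k m (v ~?_) two-of-three-close
                                 (λ Q? Q⊆N clique → neighbour-clique-count Q? clique Q⊆N) ⟩
          m * suc m         ≡⟨ trans (*-suc m m) (+-comm m _) ⟩
          m * m + m         ∎)
        4m≤m² : 4 * m ≤ m * m
        4m≤m² = *-monoˡ-≤ m 4≤m
        6≤m² : 6 ≤ m * m
        6≤m² = ≤-trans (m≤m+n 6 10) (*-mono-≤ 4≤m 4≤m)
        10+m≤2m² : 10 + m ≤ 2 * (m * m)
        10+m≤2m² = begin
          10 + m           ≤⟨ +-monoˡ-≤ m (≤-trans (m≤m+n 10 18) (*-monoʳ-≤ 7 4≤m)) ⟩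
          7 * m + m        ≡⟨ solve 1 (λ m → con 7 :* m :+ m := con 2 :* (con 4 :* m)) refl m ⟩
          2 * (4 * m)      ≤⟨ *-monoʳ-≤ 2 4m≤m² ⟩
          2 * (m * m)      ∎
        -- The target S + s + 5 ≤ 2m² is multiplied by 2 + s so that `counted` applies without
        -- division.
        scaled : (2 + s) * (S + s + 5) ≤ (2 + s) * (2 * (m * m))
        scaled = begin
          (2 + s) * (S + s + 5)
            ≡⟨ solve 2 (λ s S → (con 2 :+ s) :* (S :+ s :+ con 5) := (con 2 :+ s) :* S :+ (con 2 :+ s) :* (s :+ con 5)) refl s S ⟩
          (2 + s) * S + (2 + s) * (s + 5)
            ≤⟨ +-monoˡ-≤ _ counted ⟩
          (suc (m + m) + s) * m + (2 + s) * (s + 5)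
            ≡⟨ solve 2 (λ m s → (con 1 :+ (m :+ m) :+ s) :* m :+ (con 2 :+ s) :* (s :+ con 5)
                 := s :* (s :+ m :+ con 1) :+ s :* con 6 :+ (con 10 :+ m) :+ con 2 :* (m :* m)) refl m s ⟩
          s * (s + m + 1) + s * 6 + (10 + m) + 2 * (m * m)
            ≤⟨ +-monoˡ-≤ _ (+-mono-≤ (+-mono-≤ (*-monoʳ-≤ s s+m+1≤m²) (*-monoʳ-≤ s 6≤m²)) 10+m≤2m²) ⟩
          s * (m * m) + s * (m * m) + 2 * (m * m) + 2 * (m * m)
            ≡⟨ solve 2 (λ q s → s :* q :+ s :* q :+ con 2 :* q :+ con 2 :* q := (con 2 :+ s) :* (con 2 :* q)) refl (m * m) s ⟩
          (2 + s) * (2 * (m * m)) ∎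

      module _ (d≡2m : d ≡ m + m) where

        -- For d = 2m, `count-common≥` already forces m - 1 common neighbours. One more guarantees a
        -- second foot in `rich-feet`.
        Rich : Fin n → Set
        Rich u = v ~ u × m ≤ count (common? u)

        rich-feet : ∀ {u w} → Rich u → u ~ w → ¬ v ≈ w → 2 ≤ count (feet? w)
        rich-feet (v~u , m≤) u~w v≉w = +-cancelʳ-≤ m _ _
          (≤-trans (+-monoʳ-≤ 2 m≤) (count-common≤ (v~u , u~w , v≉w)))

        -- Every neighbour of v other than x and z is adjacent to x or z, and u to both.
        rich-end : ∀ {u x z} → v ~ u → v ~ x → v ~ z → u ~ x → u ~ z → ¬ x ≈ z → Rich x ⊎ Rich z
        rich-end {u} {x} {z} v~u v~x v~z u~x u~z x≉z with m ≤? count (common? x) | m ≤? count (common? z)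
        ... | yes m≤x | _       = inj₁ (v~x , m≤x)
        ... | no _    | yes m≤z = inj₂ (v~z , m≤z)
        ... | no m≰x  | no m≰z  = contradiction bound (<⇒≱ ≤-refl)
          where
          open ≤-Reasoning
          -- `u` is adjacent to both `x` and `z`; leaving it out on one side saves the unit that the
          -- contradiction needs.
          without? : Decidable (λ y → (v ~ y × z ~ y) × y ≢ u)
          without? y = common? z y ×-dec ¬? (y ≟ u)
          ends? = λ y → (y ≟ x) ⊎-dec (y ≟ z)
          rest? = λ y → common? x y ⊎-dec without? y
          split : ∀ {y} → v ~ y → (y ≡ x ⊎ y ≡ z) ⊎ (v ~ y × x ~ y) ⊎ ((v ~ y × z ~ y) × y ≢ u)
          split {y} v~y with y ≟ u
          ... | yes refl = inj₂ (inj₁ (v~y , ~-sym u~x))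
          ... | no y≢u with two-of-three-close v~x v~z v~y
          ... | inj₁ x≈z               = contradiction x≈z x≉z
          ... | inj₂ (inj₁ (inj₁ eq))  = inj₁ (inj₁ (≡-sym eq))
          ... | inj₂ (inj₁ (inj₂ x~y)) = inj₂ (inj₁ (v~y , x~y))
          ... | inj₂ (inj₂ (inj₁ eq))  = inj₁ (inj₂ (≡-sym eq))
          ... | inj₂ (inj₂ (inj₂ z~y)) = inj₂ (inj₂ ((v~y , z~y) , y≢u))
          single : ∀ a → count (_≟ a) ≤ 1
          single a = count-subsingleton (_≟ a) λ { refl refl → refl }
          bound : suc (m + m) ≤ m + m
          bound = begin
            suc (m + m)
              ≡⟨ cong suc (≡-sym d≡2m) ⟩
            suc d
              ≤⟨ s≤s (count-cover (v ~?_) ends? rest? split) ⟩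
            suc (count ends? + count rest?)
              ≤⟨ s≤s (+-mono-≤ (≤-trans (count-cover ends? (_≟ x) (_≟ z) (λ e → e)) (+-mono-≤ (single x) (single z)))
                               (count-cover rest? (common? x) without? (λ e → e))) ⟩
            3 + (count (common? x) + count without?)
              ≡⟨ cong (2 +_) (≡-sym (+-suc _ _)) ⟩
            2 + (count (common? x) + suc (count without?))
              ≤⟨ +-monoʳ-≤ 2 (+-monoʳ-≤ (count (common? x)) (≤-trans
                   (count-insert without? {u} (λ (_ , u≢u) → u≢u refl))
                   (count-mono (insert? without? u) (common? z)
                     λ { (inj₁ refl) → v~u , ~-sym u~z ; (inj₂ (c , _)) → c }))) ⟩
            2 + (count (common? x) + count (common? z))
              ≡⟨ cong suc (≡-sym (+-suc _ _)) ⟩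
            suc (count (common? x)) + suc (count (common? z))
              ≤⟨ +-mono-≤ (≰⇒> m≰x) (≰⇒> m≰z) ⟩
            m + m ∎

        -- A clique of common neighbours of `u` and `v` has at most m - 1 vertices, so two common
        -- neighbours are nonadjacent. One of them is rich, and it differs from `u` because it is
        -- adjacent to `u`.
        another-rich : ∀ {u} → Rich u → ∃[ u′ ] (Rich u′ × u ≢ u′)
        another-rich {u} (v~u , m≤) with clique⊎nonadjacent (common? u)
        ... | inj₁ clique = contradiction
          (common-neighbour-clique-count (common? u) clique v~u proj₁ proj₂) (≤⇒≯ m≤)
        ... | inj₂ (x , z , (v~x , u~x) , (v~z , u~z) , x≉z) with rich-end v~u v~x v~z u~x u~z x≉z
        ... | inj₁ rich-x = x , rich-x , ~⇒≢ u~x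
        ... | inj₂ rich-z = z , rich-z , ~⇒≢ u~z

        -- Two rich vertices get weight 1 and the other neighbours of `v` weight 2, at most 4m - 2
        -- in total. A second neighbour adjacent to one of the two has two feet, and any other has a
        -- foot of weight 2. Hence 2S ≤ (4m - 2)m, and the m saved in S ≤ 2m² - m pays for the 4 in
        -- `Good`.
        good-if-rich : ∀ {u} → Rich u → Good
        good-if-rich {u₁} rich₁ with u₂ , rich₂ , u₁≢u₂ ← another-rich rich₁ = begin
          count squareAdj? + 4          ≤⟨ +-mono-≤ squareDegree≤ 4≤m ⟩
          d + S + m                     ≡⟨ cong (λ z → z + S + m) d≡2m ⟩
          m + m + S + m                 ≡⟨ +-assoc (m + m) S m ⟩
          m + m + (S + m)               ≤⟨ +-monoʳ-≤ (m + m) (*-cancelˡ-≤ {S + m} {2 * (m * m)} 2 doubled) ⟩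
          m + m + 2 * (m * m)           ≡⟨ solve 1 (λ m → m :+ m :+ con 2 :* (m :* m) := con 2 :* (con 1 :+ m) :* m) refl m ⟩
          2 * suc m * m                 ∎
          where
          open ≤-Reasoning
          open +-*-Solver
          S = count second?
          Other = λ u → v ~ u × u ≢ u₁ × u ≢ u₂
          other? : Decidable Other
          other? u = (v ~? u) ×-dec ¬? (u ≟ u₁) ×-dec ¬? (u ≟ u₂)
          not₁? = insert? other? u₂
          other≤ : 2 + count other? ≤ d
          other≤ = begin
            2 + count other?             ≤⟨ s≤s (count-insert other? λ (_ , _ , u₂≢u₂) → u₂≢u₂ refl) ⟩
            1 + count not₁?              ≤⟨ count-insert not₁? (λ { (inj₁ eq) → u₁≢u₂ eq ; (inj₂ (_ , u₁≢u₁ , _)) → u₁≢u₁ refl }) ⟩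
            count (insert? not₁? u₁)     ≤⟨ count-mono (insert? not₁? u₁) (v ~?_)
                                              (λ { (inj₁ refl) → proj₁ rich₁ ; (inj₂ (inj₁ refl)) → proj₁ rich₂ ; (inj₂ (inj₂ (v~u , _))) → v~u }) ⟩
            d                            ∎
          g : Fin n → ℕ
          g u = N u + indicator (other? u)
          weight≥2 : ∀ {w} → Second w → 2 ≤ sum (λ u → g u * indicator (outside? u w))
          weight≥2 {w} sec@(v≉w , u , v~u , u~w) with u ≟ u₁ | u ≟ u₂
          ... | yes refl | _ = ≤-trans (≤-trans (rich-feet rich₁ u~w v≉w) (count-feet≤ sec))
                  (sum-mono-≤ λ u → *-monoˡ-≤ (indicator (outside? u w)) (m≤m+n (N u) _))
          ... | no _ | yes refl = ≤-trans (≤-trans (rich-feet rich₂ u~w v≉w) (count-feet≤ sec))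
                  (sum-mono-≤ λ u → *-monoˡ-≤ (indicator (outside? u w)) (m≤m+n (N u) _))
          ... | no u≢u₁ | no u≢u₂ = ≤-trans (≤-reflexive (≡-sym term≡2)) (term≤sum (λ u → g u * indicator (outside? u w)) u)
            where
            term≡2 : g u * indicator (outside? u w) ≡ 2
            term≡2 rewrite indicator-true (v ~? u) v~u
                         | indicator-true (other? u) (v~u , u≢u₁ , u≢u₂)
                         | indicator-true (outside? u w) (v~u , u~w , v≉w) = refl
          doubled : 2 * (S + m) ≤ 2 * (2 * (m * m))
          doubled = begin
            2 * (S + m)                     ≡⟨ *-distribˡ-+ 2 S m ⟩
            2 * S + 2 * m                   ≤⟨ +-monoˡ-≤ (2 * m) (double-count g 2 weight≥2) ⟩
            sum g * m + 2 * m               ≡⟨ cong (λ z → z * m + 2 * m) (∑-distrib-+ N (indicator ∘ other?)) ⟩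
            (d + count other?) * m + 2 * m  ≡⟨ solve 3 (λ d o m → (d :+ o) :* m :+ con 2 :* m := (d :+ (con 2 :+ o)) :* m) refl d (count other?) m ⟩
            (d + (2 + count other?)) * m    ≤⟨ *-monoˡ-≤ m (+-monoʳ-≤ d other≤) ⟩
            (d + d) * m                     ≡⟨ cong (λ z → (z + z) * m) d≡2m ⟩
            (m + m + (m + m)) * m           ≡⟨ solve 1 (λ m → (m :+ m :+ (m :+ m)) :* m := con 2 :* (con 2 :* (m :* m))) refl m ⟩
            2 * (2 * (m * m))               ∎

      -- For d = 2m, a path in N(v) with nonadjacent ends yields a rich vertex. Absence of such
      -- paths is transitivity of closeness.
      good⊎cluster : Good ⊎ Cluster × TwoSided
      good⊎cluster with <-cmp d (m + m)
      ... | tri< d<2m _ _ = inj₁ (good-if-few d<2m)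
      ... | tri> _ _ 2m<d = inj₁ (good-if-many 2m<d)
      ... | tri≈ _ d≡2m _ with any? (λ u → any? λ x → any? λ z →
              (v ~? u) ×-dec (v ~? x) ×-dec (v ~? z) ×-dec (u ~? x) ×-dec (u ~? z) ×-dec ¬? (x ≈? z))
      ... | yes (u , x , z , v~u , v~x , v~z , u~x , u~z , x≉z) =
              inj₁ ([ good-if-rich d≡2m , good-if-rich d≡2m ]′ (rich-end d≡2m v~u v~x v~z u~x u~z x≉z))
      ... | no none = inj₂ (cluster , two-sided)
        where
        cluster : Cluster
        cluster v~x v~y v~z (inj₁ refl) y≈z         = y≈z
        cluster v~x v~y v~z (inj₂ x~y)  (inj₁ refl) = inj₂ x~y
        cluster {x} {y} {z} v~x v~y v~z (inj₂ x~y) (inj₂ y~z) = decidable-stable (x ≈? z) λ x≉z →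
          none (y , x , z , v~y , v~x , v~z , ~-sym x~y , y~z , x≉z)
        two-sided : TwoSided
        two-sided with clique⊎nonadjacent (v ~?_)
        ... | inj₂ found  = found
        -- N(v) has 2m > m vertices, too many for a single clique.
        ... | inj₁ clique = contradiction
          (≤-trans (≤-reflexive (≡-sym d≡2m)) (neighbour-clique-count (v ~?_) clique (λ v~x → v~x)))
          (<⇒≱ (m<m+n m (≤-trans (s≤s z≤n) 4≤m)))

-- Colourings

missing-value : ∀ {d k} → d < k → (f : Fin d → Fin k) → ∃[ c ] (∀ i → f i ≢ c)
missing-value d<k f with any? (λ c → all? λ i → ¬? (f i ≟ c))
... | yes found = found
... | no none = contradiction i≡j (Finₚ.<⇒≢ i<j)
  where
  preimage : ∀ c → ∃[ i ] f i ≡ c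
  preimage c with any? (λ i → f i ≟ c)
  ... | yes found = found
  ... | no empty  = contradiction (c , λ i eq → empty (i , eq)) none
  collision = pigeonhole d<k (proj₁ ∘ preimage)
  i<j = proj₁ (proj₂ (proj₂ collision))
  i≡j : proj₁ collision ≡ proj₁ (proj₂ collision)
  i≡j = trans (≡-sym (proj₂ (preimage _)))
    (trans (cong f (proj₂ (proj₂ (proj₂ collision)))) (proj₂ (preimage _)))

module _ {n k : ℕ} {R : Fin n → Fin n → Set} (R? : ∀ x → Decidable (R x))
  (R-sym : ∀ {x y} → R x y → R y x) (R-irrefl : ∀ {x} → ¬ R x x) where

  ProperOn : (Fin n → Set) → (Fin n → Fin k) → Set
  ProperOn P c = ∀ {x y} → P x → P y → R x y → c x ≢ c y

  greedy-step : ∀ {P} v → count (R? v) < k →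
    ∃ (ProperOn P) → ∃ (ProperOn (λ x → x ≡ v ⊎ P x))
  greedy-step {P} v deg<k (c , proper) = c′ , proper′
    where
    e = enumerate (R? v)
    free = missing-value deg<k (c ∘ element e)
    fresh : ∀ {y} → R v y → proj₁ free ≢ c y
    fresh r eq with i , refl ← complete e r = proj₂ free i (≡-sym eq)
    c′ : Fin n → Fin k
    c′ x with x ≟ v
    ... | yes _ = proj₁ free
    ... | no _  = c x
    proper′ : ProperOn (λ x → x ≡ v ⊎ P x) c′
    proper′ {x} {y} px py r eq with x ≟ v | y ≟ v
    proper′ _ _ r eq | yes refl | yes refl = R-irrefl r
    proper′ _ _ r eq | yes refl | no _ = fresh r eq
    proper′ _ _ r eq | no _ | yes refl = fresh (R-sym r) (≡-sym eq)
    proper′ (inj₁ x≡v) _ r eq | no x≢v | no _ = x≢v x≡v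
    proper′ _ (inj₁ y≡v) r eq | no _ | no y≢v = y≢v y≡v
    proper′ (inj₂ p) (inj₂ q) r eq | no _ | no _ = proper p q r eq

  -- The vertices of `B`, on which no degree bound is assumed, are coloured beforehand. The others
  -- follow one at a time, each with fewer than k neighbours and hence a free colour.
  greedy-extension : ∀ {B} → Decidable B → (∀ v → ¬ B v → count (R? v) < k) → Fin k →
    (c₀ : ∀ x → B x → Fin k) → (∀ {x y} (bx : B x) (by : B y) → R x y → c₀ x bx ≢ c₀ y by) →
    ∃[ c ] (∀ x y → R x y → c x ≢ c y)
  greedy-extension {B} B? deg<k default c₀ proper₀ = let c , proper = extend (allFin n) in
    c , λ x y → proper (inj₂ (∈-allFin x)) (inj₂ (∈-allFin y))
    where
    total : Fin n → Fin k
    total x with B? x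
    ... | yes b = c₀ x b
    -- A placeholder: properness is claimed on `B` only, and these vertices are recoloured when
    -- `extend` treats them.
    ... | no _  = default
    total-proper : ProperOn B total
    total-proper {x} {y} bx by r eq with B? x | B? y
    ... | no ¬bx | _      = ¬bx bx
    ... | yes _  | no ¬by = ¬by by
    ... | yes b  | yes b′ = proper₀ b b′ r eq
    extend : ∀ vs → ∃ (ProperOn (λ x → B x ⊎ x ∈ vs))
    extend [] = total , λ { (inj₁ p) (inj₁ q) → total-proper p q }
    extend (v ∷ vs) with B? v
    ... | yes b = let c , proper = extend vs in
      c , λ p q → proper (drop p) (drop q)
      where
      drop : ∀ {x} → B x ⊎ x ∈ v ∷ vs → B x ⊎ x ∈ vs
      drop (inj₁ p)            = inj₁ p
      drop (inj₂ (here refl))  = inj₁ b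
      drop (inj₂ (there x∈vs)) = inj₂ x∈vs
    ... | no ¬b = let c , proper = greedy-step v (deg<k v ¬b) (extend vs) in
      c , λ p q → proper (shift p) (shift q)
      where
      shift : ∀ {x} → B x ⊎ x ∈ v ∷ vs → x ≡ v ⊎ B x ⊎ x ∈ vs
      shift (inj₁ p)            = inj₂ (inj₁ p)
      shift (inj₂ (here refl))  = inj₁ refl
      shift (inj₂ (there x∈vs)) = inj₂ (inj₂ x∈vs)

-- Existence of chromatic numbers of finite graphs

least-witness : ∀ {P : ℕ → Set} → Decidable P → ∀ {N} → P N →
  ∃[ k ] (P k × (∀ j → P j → k ≤ j))
least-witness {P} P? {N} pN = [ (λ found → found) , (λ N< → contradiction (N< N pN) (<⇒≱ ≤-refl)) ]′ (search (suc N))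
  where
  search : ∀ b → (∃[ k ] (P k × (∀ j → P j → k ≤ j))) ⊎ (∀ j → P j → b ≤ j)
  search zero = inj₂ λ _ _ → z≤n
  search (suc b) with search b
  ... | inj₁ found = inj₁ found
  ... | inj₂ b≤ with P? b
  ... | yes pb = inj₁ (b , pb , b≤)
  ... | no ¬pb = inj₂ λ j pj → ≤∧≢⇒< (b≤ j pj) λ { refl → ¬pb pj }

-- A retraction of `Fin size` onto `A`, so a listing may repeat elements.
record Finite (A : Set) : Set where
  field
    size     : ℕ
    at       : Fin size → A
    index    : A → Fin size
    at-index : ∀ x → at (index x) ≡ x

  index-injective : ∀ {x y} → index x ≡ index y → x ≡ y
  index-injective {x} {y} eq = trans (≡-sym (at-index x)) (trans (cong at eq) (at-index y))

  equal? : ∀ (x y : A) → Dec (x ≡ y)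
  equal? x y = map′ index-injective (cong index) (index x ≟ index y)

  exists? : ∀ {P : A → Set} → Decidable P → Dec (∃ P)
  exists? {P} P? = map′ (λ (i , p) → at i , p) (λ (x , p) → index x , subst P (≡-sym (at-index x)) p)
    (any? (P? ∘ at))

listed⇒finite : ∀ {A : Set} (xs : List A) → (∀ x → x ∈ xs) → Finite A
listed⇒finite xs all = record
  { size = length xs ; at = lookup xs ; index = Any.index ∘ all
  ; at-index = λ x → ≡-sym (lookup-index (all x)) }

module _ (X : Graph) (finite : Finite (V X)) (adj? : ∀ x y → Dec (Adj X x y)) where
  open Finite finite

  square-adj? : ∀ x y → Dec (Adj (Square X) x y)
  square-adj? x y = ¬? (equal? x y) ×-dec
    (adj? x y ⊎-dec exists? (λ z → adj? x z ×-dec adj? z y))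

  colourable? : ∀ k → Dec (Colourable X k)
  colourable? k = map′ fromIndices toIndices
    (any? λ t → all? λ i → all? λ j → adj? (at i) (at j) →-dec ¬? (colouring t i ≟ colouring t j))
    where
    colouring : Fin (k ^ size) → Fin size → Fin k
    colouring = finToFun
    Proper : (Fin size → Fin k) → Set
    Proper f = ∀ i j → Adj X (at i) (at j) → f i ≢ f j
    fromIndices : ∃ (Proper ∘ colouring) → Colourable X k
    fromIndices (t , proper) = colouring t ∘ index , λ x y a →
      proper (index x) (index y) (subst (λ z → Adj X z _) (≡-sym (at-index x)) (subst (Adj X x) (≡-sym (at-index y)) a))
    toIndices : Colourable X k → ∃ (Proper ∘ colouring)
    toIndices (c , proper) = funToFin (c ∘ at) , λ i j a eq → proper (at i) (at j) a
      (trans (≡-sym (finToFun-funToFin (c ∘ at) i)) (trans eq (finToFun-funToFin (c ∘ at) j)))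

  chromatic-number : ∃ (IsChromaticNumber X)
  chromatic-number = least-witness colourable? {size}
    -- Giving each vertex its own index as colour shows that some number of colours suffices.
    (index , λ x y a eq → Graph.irrefl X (subst (Adj X x) (≡-sym (index-injective eq)) a))

-- Line graphs

module _ {m : ℕ} (H : SimpleGraph m) where

  IsEdge : Fin m × Fin m → Set
  IsEdge p = (proj₁ p Fin.< proj₂ p) × T (adj H (proj₁ p) (proj₂ p))

  isEdge? : Decidable IsEdge
  isEdge? (i , j) = (i Finₚ.<? j) ×-dec T? (adj H i j)

  Edge-finite : Finite (Edge H)
  Edge-finite = listed⇒finite (concatMap edges pairs) listed
    where
    pairs = cartesianProduct (allFin m) (allFin m)
    edges : Fin m × Fin m → List (Edge H)
    edges p with isEdge? p
    ... | yes e = (p , e) ∷ []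
    ... | no _  = []
    own : ∀ p (e : IsEdge p) → (p , e) ∈ edges p
    own p e with isEdge? p
    ... | yes e′ = here (cong (p ,_) (cong₂ _,_ (Finₚ.<-irrelevant _ _) (T-irrelevant _ _)))
    ... | no ¬e  = contradiction e ¬e
    listed : ∀ e → e ∈ concatMap edges pairs
    listed (p@(i , j) , e) = ∈-concatMap⁺ edges (lose (∈-cartesianProduct⁺ (∈-allFin i) (∈-allFin j)) (own p e))

  private
    ends : Edge H → Fin m × Fin m
    ends = endpoints {H = H}

  infix 4 _∋ₑ_

  _∋ₑ_ : Edge H → Fin m → Set
  e ∋ₑ x = _∈ₑ_ {H = H} x e

  ends-equal? : ∀ (e f : Edge H) → Dec (ends e ≡ ends f)
  ends-equal? e f = ×-≡-dec _≟_ _≟_ (ends e) (ends f)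

  line-adj? : ∀ e f → Dec (Adj (LineGraph H) e f)
  line-adj? e f = ¬? (ends-equal? e f) ×-dec any? (λ x → end? x e ×-dec end? x f)
    where
    end? : ∀ x e → Dec (e ∋ₑ x)
    end? x e = (x ≟ proj₁ (ends e)) ⊎-dec (x ≟ proj₂ (ends e))

  square-line-chromatic-number : ∃ (IsChromaticNumber (Square (LineGraph H)))
  square-line-chromatic-number = chromatic-number (Square (LineGraph H)) Edge-finite
    (square-adj? (LineGraph H) Edge-finite line-adj?)

  -- An `Edge` stores its ends in increasing order; this hides the order.
  edge-between : ∀ i j → T (adj H i j) →
    Σ (Edge H) λ e → e ∋ₑ i × e ∋ₑ j × (∀ {k} → e ∋ₑ k → k ≡ i ⊎ k ≡ j)
  edge-between i j a with Finₚ.<-cmp i j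
  ... | tri< i<j _ _ = ((i , j) , i<j , a) , inj₁ refl , inj₂ refl , λ p → p
  ... | tri≈ _ refl _ = contradiction a (Graph.irrefl (toGraph H))
  ... | tri> _ _ j<i = ((j , i) , j<i , Graph.sym (toGraph H) a) , inj₂ refl , inj₁ refl
                       , λ { (inj₁ p) → inj₂ p ; (inj₂ p) → inj₁ p }

  same-ends : ∀ {e f} → ends e ≡ ends f → ∀ {k} → e ∋ₑ k → f ∋ₑ k
  same-ends eq {k} = subst (λ p → k ≡ proj₁ p ⊎ k ≡ proj₂ p) eq

  -- If i and j are adjacent, the edge ij links `e` to `f` in the line graph; if it coincides with
  -- one of them, then `e` and `f` share an end.
  square-line-adj : ∀ {e f i j} → ends e ≢ ends f → e ∋ₑ i → f ∋ₑ j → i ≡ j ⊎ T (adj H i j) →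
    Adj (Square (LineGraph H)) e f
  square-line-adj e≢f i∈e j∈f (inj₁ refl) = (λ eq → e≢f (cong ends eq)) , inj₁ (e≢f , _ , i∈e , j∈f)
  square-line-adj {e} {f} {i} {j} e≢f i∈e j∈f (inj₂ a) with edge-between i j a
  ... | g , i∈g , j∈g , _ with ends-equal? g e | ends-equal? g f
  ... | yes g≡e | _       = square-line-adj {e} {f} e≢f (same-ends {g} {e} g≡e j∈g) j∈f (inj₁ refl)
  ... | no _    | yes g≡f = square-line-adj {e} {f} e≢f i∈e (same-ends {g} {f} g≡f i∈g) (inj₁ refl)
  ... | no g≢e  | no g≢f  = (λ eq → e≢f (cong ends eq)) ,
    inj₂ (g , ((λ eq → g≢e (≡-sym eq)) , i , i∈e , i∈g) , (g≢f , j , j∈g , j∈f))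

-- Raising the maximum degree

module _ {m : ℕ} (H : SimpleGraph m) (ω : ℕ) where

  private
    adj⁺ : Fin m ⊎ Fin (suc ω) → Fin m ⊎ Fin (suc ω) → Bool
    adj⁺ (inj₁ i)       (inj₁ j)       = adj H i j
    adj⁺ (inj₂ zero)    (inj₂ (suc _)) = true
    adj⁺ (inj₂ (suc _)) (inj₂ zero)    = true
    adj⁺ _              _              = false

    adj⁺-sym : ∀ s t → adj⁺ s t ≡ adj⁺ t s
    adj⁺-sym (inj₁ i)       (inj₁ j)       = adj-sym H i j
    adj⁺-sym (inj₁ _)       (inj₂ zero)    = refl
    adj⁺-sym (inj₁ _)       (inj₂ (suc _)) = refl
    adj⁺-sym (inj₂ zero)    (inj₁ _)       = refl
    adj⁺-sym (inj₂ (suc _)) (inj₁ _)       = refl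
    adj⁺-sym (inj₂ zero)    (inj₂ zero)    = refl
    adj⁺-sym (inj₂ zero)    (inj₂ (suc _)) = refl
    adj⁺-sym (inj₂ (suc _)) (inj₂ zero)    = refl
    adj⁺-sym (inj₂ (suc _)) (inj₂ (suc _)) = refl

    adj⁺-irrefl : ∀ s → adj⁺ s s ≡ false
    adj⁺-irrefl (inj₁ i)       = adj-irrefl H i
    adj⁺-irrefl (inj₂ zero)    = refl
    adj⁺-irrefl (inj₂ (suc _)) = refl

  -- A disjoint star K_{1,ω} raises the maximum degree to exactly ω.
  addStar : SimpleGraph (m + suc ω)
  addStar = record
    { adj = λ u v → adj⁺ (splitAt m u) (splitAt m v)
    ; adj-sym = λ u v → adj⁺-sym (splitAt m u) (splitAt m v)
    ; adj-irrefl = λ v → adj⁺-irrefl (splitAt m v) }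

  addStar-maxDegree : 1 ≤ ω → (∀ v → ¬ HasNeighbours (toGraph H) v (suc ω)) →
    IsMaxDegree (toGraph addStar) ω
  addStar-maxDegree 1≤ω deg≤ω = (m ↑ʳ zero , leaf , leaf-injective , leaf-adj) , λ v (f , f-inj , f-adj) →
    bound (splitAt m v) (splitAt m ∘ f) (λ {i} {j} eq → f-inj i j
      (trans (≡-sym (join-splitAt m _ (f i))) (trans (cong (join m _) eq) (join-splitAt m _ (f j))))) f-adj
    where
    leaf : Fin ω → Fin (m + suc ω)
    leaf i = m ↑ʳ suc i
    leaf-injective : ∀ i j → leaf i ≡ leaf j → i ≡ j
    leaf-injective i j eq = suc-injective (↑ʳ-injective m _ _ eq)
    leaf-adj : ∀ i → T (adj⁺ (splitAt m (m ↑ʳ zero)) (splitAt m (leaf i)))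
    leaf-adj i rewrite splitAt-↑ʳ m (suc ω) zero | splitAt-↑ʳ m (suc ω) (suc i) = tt
    bound : ∀ s (g : Fin (suc ω) → Fin m ⊎ Fin (suc ω)) → (∀ {i j} → g i ≡ g j → i ≡ j) →
      (∀ i → T (adj⁺ s (g i))) → ⊥
    bound (inj₁ a) g g-inj g-adj = deg≤ω a ((proj₁ ∘ old)
      , (λ i j eq → g-inj (trans (proj₁ (proj₂ (old i))) (trans (cong inj₁ eq) (≡-sym (proj₁ (proj₂ (old j)))))))
      , λ i → proj₂ (proj₂ (old i)))
      where
      old : ∀ i → ∃[ b ] (g i ≡ inj₁ b × T (adj H a b))
      old i with g i | g-adj i
      ... | inj₁ b | t = b , refl , t
    bound (inj₂ zero) g g-inj g-adj = contradiction (injective⇒≤ {f = proj₁ ∘ leaves}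
      λ {i} {j} eq → g-inj (trans (proj₂ (leaves i)) (trans (cong (inj₂ ∘ suc) eq) (≡-sym (proj₂ (leaves j))))))
      (<⇒≱ ≤-refl)
      where
      leaves : ∀ i → ∃[ b ] g i ≡ inj₂ (suc b)
      leaves i with g i | g-adj i
      ... | inj₂ (suc b) | _ = b , refl
    -- Every neighbour of a leaf is the centre, so ω + 1 ≥ 2 distinct ones cannot exist.
    bound (inj₂ (suc _)) g g-inj g-adj = contradiction (injective⇒≤ {f = λ _ → zero {0}}
      λ {i} {j} _ → g-inj (trans (centre i) (≡-sym (centre j)))) (<⇒≱ (s≤s 1≤ω))
      where
      centre : ∀ i → g i ≡ inj₂ zero
      centre i with g i | g-adj i
      ... | inj₂ zero | _ = refl

  -- The edges of `H` embed into those of `addStar` with square adjacency preserved, so colourings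
  -- pull back.
  addStar-colourable : ∀ {k} → Colourable (Square (LineGraph addStar)) k → Colourable (Square (LineGraph H)) k
  addStar-colourable (c , proper) = c ∘ embed , λ e f a → proper (embed e) (embed f) (square a)
    where
    _⁺ : Fin m → Fin (m + suc ω)
    i ⁺ = i ↑ˡ suc ω
    embed : Edge H → Edge addStar
    embed ((i , j) , i<j , a) = (i ⁺ , j ⁺)
      , subst (suc _ ≤_) (≡-sym (toℕ-↑ˡ j (suc ω))) (subst (λ z → suc z ≤ _) (≡-sym (toℕ-↑ˡ i (suc ω))) i<j)
      , subst T (≡-sym (cong₂ adj⁺ (splitAt-↑ˡ m i (suc ω)) (splitAt-↑ˡ m j (suc ω)))) a
    embed-ends : ∀ e f → proj₁ (embed e) ≡ proj₁ (embed f) → proj₁ e ≡ proj₁ f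
    embed-ends e f eq = cong₂ _,_ (↑ˡ-injective (suc ω) _ _ (cong proj₁ eq)) (↑ˡ-injective (suc ω) _ _ (cong proj₂ eq))
    embed-end : ∀ {x e} → _∈ₑ_ {H = H} x e → _∈ₑ_ {H = addStar} (x ⁺) (embed e)
    embed-end (inj₁ eq) = inj₁ (cong _⁺ eq)
    embed-end (inj₂ eq) = inj₂ (cong _⁺ eq)
    line : ∀ {e f} → Adj (LineGraph H) e f → Adj (LineGraph addStar) (embed e) (embed f)
    line {e} {f} (e≢f , x , x∈e , x∈f) = (e≢f ∘ embed-ends e f) , x ⁺ , embed-end {e = e} x∈e , embed-end {e = f} x∈f
    -- The square compares edges together with their proofs, the line graph only their end pairs.
    -- The proofs are irrelevant, so both notions agree.
    edge-≡ : ∀ {e f : Edge H} → proj₁ e ≡ proj₁ f → e ≡ f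
    edge-≡ {p , _} refl = cong (p ,_) (cong₂ _,_ (Finₚ.<-irrelevant _ _) (T-irrelevant _ _))
    square : ∀ {e f} → Adj (Square (LineGraph H)) e f → Adj (Square (LineGraph addStar)) (embed e) (embed f)
    square {e} {f} (e≢f , near) = (λ eq → e≢f (edge-≡ (embed-ends e f (cong proj₁ eq)))) , path near
      where
      path : _ ⊎ _ → _ ⊎ _
      path (inj₁ a)           = inj₁ (line {e} {f} a)
      path (inj₂ (g , a , b)) = inj₂ (embed g , line {e} {g} a , line {g} {f} b)

-- The intersection graph of the cliques at cluster vertices

from-does : ∀ {A : Set} (A? : Dec A) → T (does A?) → A
from-does (yes a) _ = a

to-does : ∀ {A : Set} (A? : Dec A) → A → T (does A?)
to-does A? a = subst T (≡-sym (dec-true A? a)) tt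

lookup-injective : ∀ {A : Set} {xs : List A} → Unique xs → ∀ {i j} → lookup xs i ≡ lookup xs j → i ≡ j
lookup-injective {xs = x ∷ xs} (x∉ ∷ unique) {zero}  {zero}  eq = refl
lookup-injective {xs = x ∷ xs} (x∉ ∷ unique) {zero}  {suc j} eq = contradiction eq (All.lookup x∉ (∈-lookup j))
lookup-injective {xs = x ∷ xs} (x∉ ∷ unique) {suc i} {zero}  eq = contradiction (≡-sym eq) (All.lookup x∉ (∈-lookup i))
lookup-injective {xs = x ∷ xs} (x∉ ∷ unique) {suc i} {suc j} eq = cong suc (lookup-injective unique eq)

module ClusterCliques {n : ℕ} (G : SimpleGraph n) (claw-free : ClawFree (toGraph G))
  (m : ℕ) (clique≤1+m : ∀ k → Clique (toGraph G) k → k ≤ suc m)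
  {B : Fin n → Set} (B? : Decidable B)
  (cluster : ∀ {x} → B x → ClawFreeGraph.Neighbourhood.Cluster G claw-free m clique≤1+m x)
  (two-sided : ∀ {x} → B x → ClawFreeGraph.Neighbourhood.TwoSided G claw-free m clique≤1+m x) where

  open ClawFreeGraph G claw-free m clique≤1+m

  infix 4 _∈ₛ_

  _∈ₛ_ : Fin n → Vec Bool n → Set
  w ∈ₛ S = T (lookupᵛ S w)

  Between : Fin n → Fin n → Fin n → Set
  Between x y w = w ≈ x × w ≈ y

  between? : ∀ x y → Decidable (Between x y)
  between? x y w = (w ≈? x) ×-dec (w ≈? y)

  -- The clique N[x] ∩ N[y], as a characteristic vector so that equal cliques are propositionally equal.
  κ : Fin n → Fin n → Vec Bool n
  κ x y = tabulate (λ w → does (between? x y w))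

  ∈κ⁻ : ∀ {x y w} → w ∈ₛ κ x y → Between x y w
  ∈κ⁻ {x} {y} {w} w∈ = from-does (between? x y w) (subst T (lookup∘tabulate _ w) w∈)

  ∈κ⁺ : ∀ {x y w} → Between x y w → w ∈ₛ κ x y
  ∈κ⁺ {x} {y} {w} b = subst T (≡-sym (lookup∘tabulate _ w)) (to-does (between? x y w) b)

  κ-cong : ∀ {x y x′ y′} → (∀ {w} → Between x y w → Between x′ y′ w) →
    (∀ {w} → Between x′ y′ w → Between x y w) → κ x y ≡ κ x′ y′
  κ-cong {x} {y} {x′} {y′} to from = tabulate-cong λ w →
    does-⇔ (mk⇔ to from) (between? x y w) (between? x′ y′ w)

  κ-comm : ∀ x y → κ x y ≡ κ y x
  κ-comm x y = κ-cong (λ (p , q) → q , p) (λ (p , q) → q , p)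

  -- Closeness is transitive on N(x), so N[x] ∩ N[y] depends only on the side of N(x) containing
  -- `y`.
  κ-cluster : ∀ {x y z} → B x → x ~ y → x ~ z → y ≈ z → κ x y ≡ κ x z
  κ-cluster {x} b x~y x~z y≈z = κ-cong (move x~y x~z y≈z) (move x~z x~y (≈-sym y≈z))
    where
    move : ∀ {y z w} → x ~ y → x ~ z → y ≈ z → Between x y w → Between x z w
    move x~y x~z y≈z (inj₁ refl , _) = inj₁ refl , inj₂ x~z
    move x~y x~z y≈z (inj₂ w~x , w≈y) = inj₂ w~x , cluster b (~-sym w~x) x~y x~z w≈y y≈z

  Special : Vec Bool n → Set
  Special S = ∃[ x ] ∃[ y ] (B x × x ~ y × S ≡ κ x y)

  special-clique : ∀ {S} → Special S → IsClique (_∈ₛ S)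
  special-clique (x , y , b , x~y , refl) p q with ∈κ⁻ p | ∈κ⁻ q
  ... | inj₁ refl , _   | w≈x , _         = ≈-sym w≈x
  ... | inj₂ w~x , _    | inj₁ refl , _   = inj₂ w~x
  ... | inj₂ w~x , w≈y  | inj₂ w′~x , w′≈y = cluster b (~-sym w~x) x~y (~-sym w′~x) w≈y (≈-sym w′≈y)

  -- Any member can serve as first argument of `κ`: a member z ≠ x lies on the side of `y`, so S = κ
  -- x z = κ z x.
  special-at : ∀ {S z} → Special S → z ∈ₛ S → ∃[ y ] (z ~ y × (B z ⊎ B y) × S ≡ κ z y)
  special-at (x , y , b , x~y , refl) z∈ with ∈κ⁻ z∈
  ... | inj₁ refl , _  = y , x~y , inj₁ b , refl
  ... | inj₂ z~x , z≈y = x , z~x , inj₂ b ,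
    trans (κ-cluster b x~y (~-sym z~x) (≈-sym z≈y)) (κ-comm x _)

  -- `κ-cluster` at `z` settles the case of `z` in `B`. Otherwise y₁ and y₂ are both in `B`, and the
  -- chain passes through κ y₁ y₂.
  κ-same-side : ∀ {z y₁ y₂} → z ~ y₁ → z ~ y₂ → B z ⊎ B y₁ → B z ⊎ B y₂ → y₁ ≈ y₂ → κ z y₁ ≡ κ z y₂
  κ-same-side z~y₁ z~y₂ (inj₁ b) _ y₁≈y₂ = κ-cluster b z~y₁ z~y₂ y₁≈y₂
  κ-same-side z~y₁ z~y₂ _ (inj₁ b) y₁≈y₂ = κ-cluster b z~y₁ z~y₂ y₁≈y₂
  κ-same-side z~y₁ z~y₂ _ _ (inj₁ refl) = refl
  κ-same-side {z} {y₁} {y₂} z~y₁ z~y₂ (inj₂ b₁) (inj₂ b₂) (inj₂ y₁~y₂) = begin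
    κ z y₁   ≡⟨ κ-comm z y₁ ⟩
    κ y₁ z   ≡⟨ κ-cluster b₁ (~-sym z~y₁) y₁~y₂ (inj₂ z~y₂) ⟩
    κ y₁ y₂  ≡⟨ κ-comm y₁ y₂ ⟩
    κ y₂ y₁  ≡⟨ κ-cluster b₂ (~-sym y₁~y₂) (~-sym z~y₂) (inj₂ (~-sym z~y₁)) ⟩
    κ y₂ z   ≡⟨ κ-comm y₂ z ⟩
    κ z y₂   ∎
    where open ≡-Reasoning

  -- The special cliques through `z` have the form κ z y, and of three such `y` in N(z) two are
  -- close.
  two-of-three-equal : ∀ {z S₁ S₂ S₃} → Special S₁ → Special S₂ → Special S₃ →
    z ∈ₛ S₁ → z ∈ₛ S₂ → z ∈ₛ S₃ → S₁ ≡ S₂ ⊎ S₁ ≡ S₃ ⊎ S₂ ≡ S₃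
  two-of-three-equal s₁ s₂ s₃ z₁ z₂ z₃ with special-at s₁ z₁ | special-at s₂ z₂ | special-at s₃ z₃
  ... | y₁ , a₁ , b₁ , refl | y₂ , a₂ , b₂ , refl | y₃ , a₃ , b₃ , refl with two-of-three-close a₁ a₂ a₃
  ... | inj₁ c        = inj₁ (κ-same-side a₁ a₂ b₁ b₂ c)
  ... | inj₂ (inj₁ c) = inj₂ (inj₁ (κ-same-side a₁ a₃ b₁ b₃ c))
  ... | inj₂ (inj₂ c) = inj₂ (inj₂ (κ-same-side a₂ a₃ b₂ b₃ c))

  -- A second member `y` determines the side of N(x), so `x` shares at most one special clique with
  -- any other vertex.
  special-through : ∀ {x y S} → B x → Special S → x ∈ₛ S → y ∈ₛ S → x ≢ y → S ≡ κ x y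
  special-through b s x∈ y∈ x≢y with special-at s x∈
  ... | y₀ , x~y₀ , _ , refl with ∈κ⁻ y∈
  ... | inj₁ refl , _    = contradiction refl x≢y
  ... | inj₂ y~x , y≈y₀ = κ-cluster b x~y₀ (~-sym y~x) (≈-sym y≈y₀)

  private
    _≟ᵛ_ : ∀ (S S′ : Vec Bool n) → Dec (S ≡ S′)
    _≟ᵛ_ = Vec-≡-dec _≟ᵇ_

    Flag : Fin n × Fin n → Set
    Flag (x , y) = B x × x ~ y

    flag? : Decidable Flag
    flag? (x , y) = B? x ×-dec (x ~? y)

    flags : List (Fin n × Fin n)
    flags = filter flag? (cartesianProduct (allFin n) (allFin n))

    κ′ : Fin n × Fin n → Vec Bool n
    κ′ (x , y) = κ x y

  abstract
    -- Many pairs give the same clique; deduplication makes distinct indices stand for distinct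
    -- cliques.
    specials : List (Vec Bool n)
    specials = deduplicate _≟ᵛ_ (map κ′ flags)

    M : ℕ
    M = length specials

    K : Fin M → Vec Bool n
    K = lookup specials

    K-injective : ∀ {i j} → K i ≡ K j → i ≡ j
    K-injective = lookup-injective (DecUnique.deduplicate-! _≟ᵛ_ (map κ′ flags))

    K-special : ∀ i → Special (K i)
    K-special i with ∈-map⁻ κ′ (∈-deduplicate⁻ _≟ᵛ_ (map κ′ flags) (∈-lookup i))
    ... | (x , y) , xy∈ , eq with ∈-filter⁻ flag? {xs = cartesianProduct (allFin n) (allFin n)} xy∈
    ... | _ , b , x~y = x , y , b , x~y , eq

    K-surjective : ∀ {x y} → B x → x ~ y → ∃[ i ] K i ≡ κ x y
    K-surjective {x} {y} b x~y = Any.index κ∈ , ≡-sym (lookup-index κ∈)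
      where
      κ∈ : κ x y ∈ specials
      κ∈ = ∈-deduplicate⁺ _≟ᵛ_ (∈-map⁺ κ′ (∈-filter⁺ flag? (∈-cartesianProduct⁺ (∈-allFin x) (∈-allFin y)) (b , x~y)))

  Meet : Fin M → Fin M → Set
  Meet i j = i ≢ j × ∃[ w ] (w ∈ₛ K i × w ∈ₛ K j)

  meet? : ∀ i j → Dec (Meet i j)
  meet? i j = ¬? (i ≟ j) ×-dec any? (λ w → T? (lookupᵛ (K i) w) ×-dec T? (lookupᵛ (K j) w))

  H : SimpleGraph M
  H = record
    { adj = λ i j → does (meet? i j)
    ; adj-sym = λ i j → does-⇔ (mk⇔ swap swap) (meet? i j) (meet? j i)
    ; adj-irrefl = λ i → dec-false (meet? i i) λ (i≢i , _) → i≢i refl }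
    where
    swap : ∀ {i j} → Meet i j → Meet j i
    swap (i≢j , w , p , q) = (λ eq → i≢j (≡-sym eq)) , w , q , p

  -- Each `H`-neighbour of `i` shares a vertex with `K i`. These vertices are distinct, since a
  -- vertex lies in at most two special cliques, so m + 2 of them would form too large a clique.
  H-degree : ∀ i → ¬ HasNeighbours (toGraph H) i (suc (suc m))
  H-degree i (f , f-inj , f-adj) = <⇒≱ ≤-refl (clique≤1+m _ (w , adjacent))
    where
    meet : ∀ a → Meet i (f a)
    meet a = from-does (meet? i (f a)) (f-adj a)
    w : Fin (suc (suc m)) → Fin n
    w a = proj₁ (proj₂ (meet a))
    w∈Ki : ∀ a → w a ∈ₛ K i
    w∈Ki a = proj₁ (proj₂ (proj₂ (meet a)))
    w∈Kf : ∀ a → w a ∈ₛ K (f a)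
    w∈Kf a = proj₂ (proj₂ (proj₂ (meet a)))
    w-injective : ∀ a b → w a ≡ w b → a ≡ b
    w-injective a b eq with two-of-three-equal (K-special i) (K-special (f a)) (K-special (f b))
                              (w∈Ki a) (w∈Kf a) (subst (_∈ₛ K (f b)) (≡-sym eq) (w∈Kf b))
    ... | inj₁ e        = contradiction (K-injective e) (proj₁ (meet a))
    ... | inj₂ (inj₁ e) = contradiction (K-injective e) (proj₁ (meet b))
    ... | inj₂ (inj₂ e) = f-inj a b (K-injective e)
    adjacent : ∀ a b → a ≢ b → w a ~ w b
    adjacent a b a≢b with special-clique (K-special i) (w∈Ki a) (w∈Ki b)
    ... | inj₁ eq = contradiction (w-injective a b eq) a≢b
    ... | inj₂ wa~wb = wa~wb

  -- The edge representing `x`: its ends are two special cliques through `x` that together contain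
  -- N[x].
  record EdgeAt (x : Fin n) : Set where
    field
      edge   : Edge H
      {end₁ end₂} : Fin M
      ends-distinct : end₁ ≢ end₂
      end₁∈edge : _∋ₑ_ H edge end₁
      end₂∈edge : _∋ₑ_ H edge end₂
      centre : ∀ {k} → _∋ₑ_ H edge k → x ∈ₛ K k
      covers : ∀ {z} → z ≈ x → ∃[ k ] (_∋ₑ_ H edge k × z ∈ₛ K k)

  open EdgeAt

  -- Nonadjacent y₁, y₂ in N(x) give two cliques meeting in `x`. They differ because y₁ is not close
  -- to y₂, and every neighbour of `x` is close to one of y₁, y₂.
  edge-at : ∀ {x} → B x → EdgeAt x
  edge-at {x} b with y₁ , y₂ , x~y₁ , x~y₂ , y₁≉y₂ ← two-sided b = record
    { edge = e ; ends-distinct = distinct ; end₁∈edge = i∈e ; end₂∈edge = j∈e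
    ; centre = λ k∈e → [ (λ { refl → x∈Ki }) , (λ { refl → x∈Kj }) ]′ (proj₂ (proj₂ (proj₂ between)) k∈e)
    ; covers = cover }
    where
    i = proj₁ (K-surjective b x~y₁)
    j = proj₁ (K-surjective b x~y₂)
    Ki : K i ≡ κ x y₁
    Ki = proj₂ (K-surjective b x~y₁)
    Kj : K j ≡ κ x y₂
    Kj = proj₂ (K-surjective b x~y₂)
    x∈Ki : x ∈ₛ K i
    x∈Ki = subst (x ∈ₛ_) (≡-sym Ki) (∈κ⁺ (inj₁ refl , inj₂ x~y₁))
    x∈Kj : x ∈ₛ K j
    x∈Kj = subst (x ∈ₛ_) (≡-sym Kj) (∈κ⁺ (inj₁ refl , inj₂ x~y₂))
    distinct : i ≢ j
    distinct eq = y₁≉y₂ (proj₂ (∈κ⁻ (subst (y₁ ∈ₛ_) (trans (≡-sym Ki) (trans (cong K eq) Kj))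
      (∈κ⁺ (inj₂ (~-sym x~y₁) , inj₁ refl)))))
    between = edge-between H i j (to-does (meet? i j) (distinct , x , x∈Ki , x∈Kj))
    e = proj₁ between
    i∈e = proj₁ (proj₂ between)
    j∈e = proj₁ (proj₂ (proj₂ between))
    cover : ∀ {z} → z ≈ x → ∃[ k ] (_∋ₑ_ H e k × z ∈ₛ K k)
    cover (inj₁ refl) = i , i∈e , x∈Ki
    cover {z} (inj₂ z~x) with two-of-three-close x~y₁ x~y₂ (~-sym z~x)
    ... | inj₁ y₁≈y₂        = contradiction y₁≈y₂ y₁≉y₂
    ... | inj₂ (inj₁ y₁≈z) = i , i∈e , subst (z ∈ₛ_) (≡-sym Ki) (∈κ⁺ (inj₂ z~x , ≈-sym y₁≈z))
    ... | inj₂ (inj₂ y₂≈z) = j , j∈e , subst (z ∈ₛ_) (≡-sym Kj) (∈κ⁺ (inj₂ z~x , ≈-sym y₂≈z))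

  -- Some `z` lies in N[x] ∩ N[x′]. The ends containing `z` on the two edges are equal or adjacent
  -- in `H`.
  edges-square-adjacent : ∀ {x x′} → B x → (ex : EdgeAt x) (ex′ : EdgeAt x′) →
    Adj (Square (toGraph G)) x x′ → Adj (Square (LineGraph H)) (edge ex) (edge ex′)
  edges-square-adjacent {x} {x′} b ex ex′ (x≢x′ , near) = joined (common near)
    where
    -- If the edges coincided, both ends would contain `x` and `x′` and thus equal κ x x′, but the
    -- ends are distinct.
    distinct : proj₁ (edge ex) ≢ proj₁ (edge ex′)
    distinct eq = ends-distinct ex (K-injective (trans (through (end₁∈edge ex)) (≡-sym (through (end₂∈edge ex)))))
      where
      through : ∀ {k} → _∋ₑ_ H (edge ex) k → K k ≡ κ x x′
      through {k} k∈ = special-through b (K-special k) (centre ex k∈)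
        (centre ex′ (same-ends H {edge ex} {edge ex′} eq k∈)) x≢x′
    common : x ~ x′ ⊎ ∃[ z ] (x ~ z × z ~ x′) → ∃[ z ] (z ≈ x × z ≈ x′)
    common (inj₁ x~x′)             = x , inj₁ refl , inj₂ x~x′
    common (inj₂ (z , x~z , z~x′)) = z , inj₂ (~-sym x~z) , inj₂ z~x′
    joined : ∃[ z ] (z ≈ x × z ≈ x′) → Adj (Square (LineGraph H)) (edge ex) (edge ex′)
    joined (z , z≈x , z≈x′) with covers ex z≈x | covers ex′ z≈x′
    ... | k , k∈ , z∈k | k′ , k′∈ , z∈k′ =
      square-line-adj H {edge ex} {edge ex′} distinct k∈ k′∈ (meeting (k ≟ k′))
      where
      meeting : Dec (k ≡ k′) → k ≡ k′ ⊎ T (adj H k k′)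
      meeting (yes eq)  = inj₁ eq
      meeting (no k≢k′) = inj₂ (to-does (meet? k k′) (k≢k′ , z , z∈k , z∈k′))

  cluster-colouring : ∀ {k} → Colourable (Square (LineGraph H)) k →
    Σ (∀ x → B x → Fin k) λ c → ∀ {x y} (bx : B x) (by : B y) → Adj (Square (toGraph G)) x y → c x bx ≢ c y by
  cluster-colouring (c , proper) = (λ x b → c (edge (edge-at b))) ,
    λ bx by a → proper _ _ (edges-square-adjacent bx (edge-at bx) (edge-at by) a)

-- Combining the two colourings

theorem1p3 : (ω : ℕ) → 5 ≤ ω → (n : ℕ) → (G : SimpleGraph n) →
    ClawFree (toGraph G) → IsCliqueNumber (toGraph G) ω →
    (c : ℕ) → IsChromaticNumber (Square (toGraph G)) c →
    (c ≤χ'ₛ ω) ⊎ (c ≤ 2 * ω * (ω ∸ 1) ∸ 3)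
theorem1p3 (suc m) (s≤s 4≤m) n G claw-free (_ , clique≤1+m) c (_ , c-least) =
  conclude (square-line-chromatic-number H⁺)
  where
  open ClawFreeGraph G claw-free m clique≤1+m using (module Neighbourhood)
  open Neighbourhood

  Bad : Fin n → Set
  Bad v = ¬ Good v

  good? : Decidable Good
  good? v = count (squareAdj? v) + 4 ≤? 2 * suc m * m

  bad? : Decidable Bad
  bad? = ¬? ∘ good?

  bad⇒cluster : ∀ {v} → Bad v → Cluster v × TwoSided v
  bad⇒cluster {v} bad = [ (λ good → contradiction good bad) , (λ s → s) ]′ (good⊎cluster v 4≤m)

  open ClusterCliques G claw-free m clique≤1+m bad? (λ bad → proj₁ (bad⇒cluster bad)) (λ bad → proj₂ (bad⇒cluster bad))

  D = 2 * suc m * m ∸ 3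

  0<D : 0 < D
  0<D = m+n≤o⇒m≤o∸n 1 (*-mono-≤ {4} {2 * suc m} {1} {m}
    (≤-trans 4≤m (≤-trans (n≤1+n m) (m≤m+n (suc m) _))) (≤-trans (s≤s z≤n) 4≤m))

  -- The 4 in `Good` splits into 1 for strictness and 3 for `D`.
  good⇒degree<D : ∀ {v} → Good v → count (squareAdj? v) < D
  good⇒degree<D {v} good = m+n≤o⇒m≤o∸n (suc (count (squareAdj? v)))
    (≤-trans (≤-reflexive (≡-sym (+-suc (count (squareAdj? v)) 3))) good)

  -- The c′ colours of the line graph are used on the bad vertices; having at least `D` colours lets
  -- the greedy extension reach the good ones.
  c≤_⊔D : ∀ c′ → Colourable (Square (LineGraph H)) c′ → c ≤ c′ ⊔ D
  c≤ c′ ⊔D line-colouring = c-least (c′ ⊔ D)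
    (greedy-extension squareAdj? (Graph.sym (Square (toGraph G))) (λ (x≢x , _) → x≢x refl) bad?
      (λ v ¬bad → ≤-trans (good⇒degree<D (decidable-stable (good? v) ¬bad)) (m≤n⊔m c′ D))
      (fromℕ< (≤-trans 0<D (m≤n⊔m c′ D)))
      (λ v bad → inject≤ (proj₁ bad-colouring v bad) (m≤m⊔n c′ D))
      (λ bx by a eq → proj₂ bad-colouring bx by a (inject≤-injective _ _ _ _ eq)))
    where
    bad-colouring = cluster-colouring line-colouring

  -- The supremum is over maximum degree exactly ω, while `H` is only known to have degree at most
  -- ω.
  H⁺ = addStar H (suc m)

  conclude : ∃ (IsChromaticNumber (Square (LineGraph H⁺))) → (c ≤χ'ₛ suc m) ⊎ (c ≤ D)
  conclude (c′ , χ′) =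
    [ (λ eq → inj₁ (_ , H⁺ , addStar-maxDegree H (suc m) (s≤s z≤n) H-degree , c′ , χ′ , subst (c ≤_) eq c≤max))
    , (λ eq → inj₂ (subst (c ≤_) eq c≤max)) ]′ (⊔-sel c′ D)
    where
    c≤max : c ≤ c′ ⊔ D
    c≤max = c≤ c′ ⊔D (addStar-colourable H (suc m) (proj₁ χ′))
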